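{- Let $\Omega$ be a $D$-set, possibly augmented with unary predicates. Let $s=(s^1,\ldots,s^n)$ be an unbounded indiscernible sequence of $n$-tuples indexed by $I$, and let $B\subseteq\Omega$. Then $s$ is weakly indiscernible over $B$ if and only if $B\cap H(s)=\emptyset$.
   Context: A $D$-set is a set $\Omega$ with a quaternary relation $D$, written $D(wx;yz)$ or $wx|yz$, satisfying for all $w,x,y,z$: (D1) $D(wx;yz)\to (D(xw;yz)\wedge D(yz;wx))$; (D2) $D(wx;yz)\to\neg D(wy;xz)$; (D3) $D(wx;yz)\to\forall v\,(D(vx;yz)\vee D(wx;yv))$; (D4) $(w\neq y\wedge x\neq y)\to D(wx;yy)$. A splitting of $\Omega$ is a partition into at least two parts (sectors) such that (i) if $a,b$ lie in a part $\Sigma$ and $c,d\notin\Sigma$ then $D(ab;cd)$, (ii) if $a,b,c,d$ lie in four distinct parts then $\neg D(ab;cd)$; a node splitting has more than two sectors. Every splitting of a subset $A$ with more than two parts extends uniquely to a node splitting of $\Omega$ whose sectors meet $A$ in the parts. Sequences are indexed by a linear order $I$; unbounded means $I$ has no least or greatest element; indiscernible means order-indiscernible over $\emptyset$; an $n$-element sequence $s$ has component sequences $s^1,\dots,s^n$ (the $k$-th coordinates), each an indiscernible sequence of single elements. An indiscernible sequence $t=(a_i)$ of single elements is constant, or petaled (pairwise distinct and no $D(a_ia_j;a_ka_\ell)$ with $i,j,k,\ell$ pairwise distinct), or monotonic (pairwise distinct and $a_ia_j|a_ka_\ell$ for $i<j<k<\ell$). Its discernible hull $H(t)$ is: $\emptyset$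 if constant; if petaled, the union of the sectors containing elements of $t$ of the node splitting of $\Omega$ extending $\{\{a_i\}:i\in I\}$; if monotonic, $t\cup H_1(t)\cup H_2(t)\cup H_3(t)$ with $H_1(t)=\{x:\exists i<j<k,\ a_ia_k|a_jx\}$, $H_2(t)=\{x:\exists i<j<k$ with no $D$-relation among distinct elements of $\{a_i,a_j,a_k,x\}\}$, $H_3(t)=\{x:\exists i<j<k<\ell,\ a_ix|a_ka_\ell\wedge a_ia_j|xa_\ell\}$. For $n$-element $s$, $H(s)=\bigcup_k H(s^k)$. $s$ is weakly indiscernible over $B$ if for every atomic formula $D(t_1t_2;t_3t_4)$ whose terms are variables or parameters from $B$, its truth value when variables are replaced by coordinates of terms of $s$ depends only on the order type of the indices used. -}

module Defs where

open import Level using (0ℓ)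
open import Data.Nat using (ℕ; suc)
open import Data.Fin as Fin using (Fin)
open import Data.Product using (Σ; ∃; ∃-syntax; _×_; _,_; proj₁; proj₂)
open import Data.Sum using (_⊎_; inj₁; inj₂)
open import Relation.Nullary using (¬_)
open import Relation.Binary.PropositionalEquality using (_≡_; _≢_)
open import Relation.Binary.Structures using (IsStrictTotalOrder; IsEquivalence)
open import Function.Bundles using (_⇔_)

record DStructure : Set₁ where
  field
    Ω  : Set
    D  : Ω → Ω → Ω → Ω → Set          -- D w x y z  reads  wx|yz
    D1 : ∀ {w x y z} → D w x y z → D x w y z × D y z w x
    D2 : ∀ {w x y z} → D w x y z → ¬ D w y x z
    D3 : ∀ {w x y z} → D w x y z → ∀ v → D v x y z ⊎ D w x y v
    D4 : ∀ {w x y} → w ≢ y → x ≢ y → D w x y y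
    U  : Set
    P  : U → Ω → Set

record LinOrder : Set₁ where
  field
    Idx   : Set
    _<_   : Idx → Idx → Set
    isSTO : IsStrictTotalOrder _≡_ _<_

Unbounded : LinOrder → Set
Unbounded I = (∀ i → ∃[ j ] (j < i)) × (∀ i → ∃[ j ] (i < j))
  where open LinOrder I

module _ (M : DStructure) where
  open DStructure M

  data Formula : ℕ → Set where
    eqF   : ∀ {k} → Fin k → Fin k → Formula k
    relD  : ∀ {k} → Fin k → Fin k → Fin k → Fin k → Formula k
    predP : ∀ {k} → U → Fin k → Formula k
    negF  : ∀ {k} → Formula k → Formula k
    andF  : ∀ {k} → Formula k → Formula k → Formula k
    exF   : ∀ {k} → Formula (suc k) → Formula k

  extend : ∀ {k} → Ω → (Fin k → Ω) → Fin (suc k) → Ω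
  extend a ρ Fin.zero    = a
  extend a ρ (Fin.suc v) = ρ v

  Sat : ∀ {k} → Formula k → (Fin k → Ω) → Set
  Sat (eqF a b)       ρ = ρ a ≡ ρ b
  Sat (relD a b c d)  ρ = D (ρ a) (ρ b) (ρ c) (ρ d)
  Sat (predP u a)     ρ = P u (ρ a)
  Sat (negF φ)        ρ = ¬ Sat φ ρ
  Sat (andF φ ψ)      ρ = Sat φ ρ × Sat ψ ρ
  Sat (exF φ)         ρ = Σ Ω λ a → Sat φ (extend a ρ)

  module _ (I : LinOrder) where
    open LinOrder I

    Increasing : ∀ {m} → (Fin m → Idx) → Set
    Increasing ι = ∀ a b → a Fin.< b → ι a < ι b

    -- s : a sequence of n-tuples indexed by I
    -- Order-indiscernible over ∅: each free variable of φ refers (via σ)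
    -- to coordinate c of the p-th element of an increasing m-tuple of indices.
    Indiscernible : ∀ {n} → (Idx → Fin n → Ω) → Set
    Indiscernible {n} s =
      ∀ m k (φ : Formula k) (σ : Fin k → Fin m × Fin n) (ι κ : Fin m → Idx) →
      Increasing ι → Increasing κ →
      Sat φ (λ v → s (ι (proj₁ (σ v))) (proj₂ (σ v))) ⇔
      Sat φ (λ v → s (κ (proj₁ (σ v))) (proj₂ (σ v)))

    -- Weak indiscernibility over B ⊆ Ω: atomic D-formulas whose four terms
    -- are variables (coordinates of terms of s) or parameters from B.
    Term : ℕ → ℕ → (Ω → Set) → Set
    Term m n B = (Fin m × Fin n) ⊎ Σ Ω B

    evalT : ∀ {m n} {B : Ω → Set} → (Idx → Fin n → Ω) → (Fin m → Idx) →
            Term m n B → Ω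
    evalT s ι (inj₁ (p , c)) = s (ι p) c
    evalT s ι (inj₂ (b , _)) = b

    WeaklyIndiscernible : ∀ {n} → (Idx → Fin n → Ω) → (Ω → Set) → Set
    WeaklyIndiscernible {n} s B =
      ∀ m (t₁ t₂ t₃ t₄ : Term m n B) (ι κ : Fin m → Idx) →
      Increasing ι → Increasing κ →
      D (evalT s ι t₁) (evalT s ι t₂) (evalT s ι t₃) (evalT s ι t₄) ⇔
      D (evalT s κ t₁) (evalT s κ t₂) (evalT s κ t₃) (evalT s κ t₄)

    Constant : (Idx → Ω) → Set
    Constant a = ∀ i j → a i ≡ a j

    PairwiseDistinct : (Idx → Ω) → Set
    PairwiseDistinct a = ∀ i j → i ≢ j → a i ≢ a j

    Petaled : (Idx → Ω) → Set
    Petaled a = PairwiseDistinct a ×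
      (∀ i j k l → i ≢ j → i ≢ k → i ≢ l → j ≢ k → j ≢ l → k ≢ l →
        ¬ D (a i) (a j) (a k) (a l))

    Monotonic : (Idx → Ω) → Set
    Monotonic a = PairwiseDistinct a ×
      (∀ i j k l → i < j → j < k → k < l → D (a i) (a j) (a k) (a l))

    -- splittings of Ω, a partition being given by an equivalence relation
    -- (sectors = equivalence classes)
    record Splitting : Set₁ where
      field
        _~_    : Ω → Ω → Set
        isEq   : IsEquivalence _~_
        twoParts : ∃[ a ] ∃[ b ] ¬ (a ~ b)
        splitI : ∀ {a b c d} → a ~ b → ¬ (a ~ c) → ¬ (a ~ d) → D a b c d
        splitII : ∀ {a b c d} → ¬ (a ~ b) → ¬ (a ~ c) → ¬ (a ~ d) →
                  ¬ (b ~ c) → ¬ (b ~ d) → ¬ (c ~ d) → ¬ D a b c d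

    NodeSplitting : Splitting → Set
    NodeSplitting S = ∃[ a ] ∃[ b ] ∃[ c ] (¬ (a ~ b) × ¬ (a ~ c) × ¬ (b ~ c))
      where open Splitting S

    -- S extends the partition {{a i} : i ∈ I} of A = {a i}: every sector
    -- meets A in (at most) one of the singleton parts
    ExtendsSingletons : Splitting → (Idx → Ω) → Set
    ExtendsSingletons S a = ∀ i j → a i ~ a j → a i ≡ a j
      where open Splitting S

    -- hull of a petaled sequence: union of the sectors containing elements of a,
    -- of the (unique) node splitting of Ω extending {{a i}}
    PetalHull : (Idx → Ω) → Ω → Set₁
    PetalHull a x = Σ Splitting λ S → NodeSplitting S × ExtendsSingletons S a ×
                    ∃[ i ] Splitting._~_ S x (a i)

    H₁ : (Idx → Ω) → Ω → Set
    H₁ a x = ∃[ i ] ∃[ j ] ∃[ k ] (i < j × j < k × D (a i) (a k) (a j) x)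

    In4 : Ω → Ω → Ω → Ω → Ω → Set
    In4 p e₁ e₂ e₃ e₄ = p ≡ e₁ ⊎ p ≡ e₂ ⊎ p ≡ e₃ ⊎ p ≡ e₄

    NoDAmong : Ω → Ω → Ω → Ω → Set
    NoDAmong e₁ e₂ e₃ e₄ = ∀ p q r u →
      In4 p e₁ e₂ e₃ e₄ → In4 q e₁ e₂ e₃ e₄ → In4 r e₁ e₂ e₃ e₄ → In4 u e₁ e₂ e₃ e₄ →
      p ≢ q → p ≢ r → p ≢ u → q ≢ r → q ≢ u → r ≢ u → ¬ D p q r u

    H₂ : (Idx → Ω) → Ω → Set
    H₂ a x = ∃[ i ] ∃[ j ] ∃[ k ] (i < j × j < k × NoDAmong (a i) (a j) (a k) x)

    H₃ : (Idx → Ω) → Ω → Set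
    H₃ a x = ∃[ i ] ∃[ j ] ∃[ k ] ∃[ l ] (i < j × j < k × k < l ×
               D (a i) x (a k) (a l) × D (a i) (a j) x (a l))

    MonoHull : (Idx → Ω) → Ω → Set
    MonoHull a x = (∃[ i ] x ≡ a i) ⊎ H₁ a x ⊎ H₂ a x ⊎ H₃ a x

    -- discernible hull H(t) of an indiscernible sequence of single elements
    -- (empty if constant)
    InHull : (Idx → Ω) → Ω → Set₁
    InHull a x = (Petaled a × PetalHull a x) ⊎ (Monotonic a × MonoHull a x)

    InHullSeq : ∀ {n} → (Idx → Fin n → Ω) → Ω → Set₁
    InHullSeq {n} s x = ∃[ c ] InHull (λ i → s i c) x

{-# OPTIONS --safe #-}
module Submission where

-- A D-relation wx|yz holds iff some cut of Ω, that is an edge of the underlying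
-- tree, separates w, x from y, z.  If b lies outside the hull of a nonconstant
-- component a of s, then a has an end ε such that every cut splitting a has b on
-- the same side as the terms of a near ε.  Now take a true instance of an atomic
-- formula and a cut witnessing it.  If the cut splits none of the components
-- involved, it witnesses every other instance as well.  If it splits one of
-- them, each parameter can be exchanged for a far term of that component, and the
-- parameter-free formula obtained is transferred by indiscernibility.
-- Conversely, b in the hull of a is related in some way to an increasing tuple of
-- terms of a, and the same relation at all increasing tuples is contradictory.

open import Defs
open import Level using (0ℓ; suc; lift; lower)
open import Data.Nat using (ℕ)
import Data.Nat as ℕ
open import Data.Bool using (Bool; true; false)
open import Data.Empty using (⊥; ⊥-elim)
open import Data.Fin using (Fin)
import Data.Fin as Fin
import Data.Fin.Properties as Fin
open import Data.Fin.Patterns using (0F; 1F; 2F; 3F)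
open import Data.List using (List; []; _∷_; lookup)
open import Data.List.Membership.Propositional.Properties using (∈-lookup)
open import Data.List.Relation.Unary.All as All using (All; []; _∷_)
open import Data.List.Relation.Unary.AllPairs using (AllPairs; []; _∷_)
open import Data.List.Relation.Unary.Any as Any using (Any; here; there)
open import Data.List.Relation.Unary.Any.Properties using (lookup-index)
open import Data.List.Relation.Unary.Linked using (Linked; [-]; _∷_)
open import Data.List.Relation.Unary.Linked.Properties using (Linked⇒AllPairs)
open import Data.Product using (Σ; ∃-syntax; _×_; _,_; proj₁; proj₂; swap)
open import Data.Sum using (_⊎_; inj₁; inj₂)
import Data.Sum as Sum
open import Relation.Nullary using (¬_; Dec; yes; no)
open import Relation.Nullary.Decidable using (map′; toWitness; _×-dec_; _→-dec_)
open import Relation.Binary.Core using (Rel)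
open import Relation.Binary.Definitions using (Trichotomous; tri<; tri≈; tri>)
open import Relation.Binary.PropositionalEquality using (_≡_; _≢_; refl; sym; cong; subst; ≢-sym)
open import Relation.Binary.Structures using (IsStrictTotalOrder; IsEquivalence)
open import Function.Bundles using (_⇔_; mk⇔; Equivalence)
open import Axiom.ExcludedMiddle using (ExcludedMiddle)

-- Sorted lists and finite index sets.

lookup-AllPairs : {A : Set} {R : Rel A 0ℓ} {xs : List A} → AllPairs R xs →
                  ∀ p q → p Fin.< q → R (lookup xs p) (lookup xs q)
lookup-AllPairs {xs = _ ∷ xs} (px ∷ _)  Fin.zero    (Fin.suc q) _ = All.lookup px (∈-lookup {xs = xs} q)
lookup-AllPairs               (_ ∷ pxs) (Fin.suc p) (Fin.suc q) (ℕ.s≤s p<q) = lookup-AllPairs pxs p q p<q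

abstract
  -- Decided by running through all quadruples; `abstract` keeps the computation from being unfolded
  -- elsewhere.
  increasing-Fin4 : (i j k l : Fin 4) → i Fin.< j → j Fin.< k → k Fin.< l →
                    i ≡ 0F × j ≡ 1F × k ≡ 2F × l ≡ 3F
  increasing-Fin4 = toWitness {a? = Fin.all? λ i → Fin.all? λ j → Fin.all? λ k → Fin.all? λ l →
    (i Fin.<? j) →-dec (j Fin.<? k) →-dec (k Fin.<? l) →-dec
    ((i Fin.≟ 0F) ×-dec (j Fin.≟ 1F) ×-dec (k Fin.≟ 2F) ×-dec (l Fin.≟ 3F))} _

-- Consequences of the D-set axioms.

module DSet (M : DStructure) where
  open DStructure M

  private variable
    v w w′ x x′ y y′ z z′ : Ω

  D-cong : w ≡ w′ → x ≡ x′ → y ≡ y′ → z ≡ z′ → D w x y z → D w′ x′ y′ z′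
  D-cong refl refl refl refl d = d

  swapˡ : D w x y z → D x w y z
  swapˡ d = proj₁ (D1 d)

  flip : D w x y z → D y z w x
  flip d = proj₂ (D1 d)

  swapʳ : D w x y z → D w x z y
  swapʳ d = flip (swapˡ (flip d))

  disjoint : D w x y z → w ≢ y
  disjoint {w} {x} {_} {z} d refl = D2 d (flip (D4 x≢w z≢w))
    where
    irr : ∀ {v} → ¬ D w w w v
    irr e = D2 e e
    x≢w : x ≢ w
    x≢w refl = irr d
    z≢w : z ≢ w
    z≢w refl = irr (flip d)

  disjointʳ : D w x y z → w ≢ z
  disjointʳ d = disjoint (swapʳ d)

  -- `D3`, used once for each choice of a left and a right point, says that v can replace that left
  -- point or that right point. By distributivity v can replace either point on the left, or either
  -- point on the right.
  join : D w x y z → ∀ v → (D v w y z × D v x y z) ⊎ (D w x y v × D w x z v)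
  join d v with D3 d v | D3 (swapˡ d) v | D3 (swapʳ d) v | D3 (swapʳ (swapˡ d)) v
  ... | inj₁ vx | inj₁ vw | _       | _       = inj₁ (vw , vx)
  ... | _       | _       | inj₁ vx | inj₁ vw = inj₁ (swapʳ vw , swapʳ vx)
  ... | inj₂ yv | _       | inj₂ zv | _       = inj₂ (yv , zv)
  ... | inj₂ yv | _       | _       | inj₂ zv = inj₂ (yv , swapˡ zv)
  ... | _       | inj₂ yv | inj₂ zv | _       = inj₂ (swapˡ yv , zv)
  ... | _       | inj₂ yv | _       | inj₂ zv = inj₂ (swapˡ yv , swapˡ zv)

  -- If w fails to join x, v and v fails to join w, x, then xv|yw and wx|yv both hold, against `D2`.
  D-transˡ : D w x y z → D x v y z → D w v y z
  D-transˡ {w} {v = v} wx xv with join xv w | join wx v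
  ... | inj₁ (_ , wv) | _ = wv
  ... | inj₂ _        | inj₁ (vw , _) = swapˡ vw
  ... | inj₂ (yw , _) | inj₂ (yv , _) = ⊥-elim (D2 (swapˡ (swapʳ yv)) (swapʳ yw))

  D-transʳ : D w x y z → D w x z v → D w x y v
  D-transʳ d e = flip (D-transˡ (flip d) (flip e))

  -- Either c lies opposite x, y, or b lies opposite y, z, and then `D-transˡ` applies. Failing
  -- both, cy|ab and by|ac contradict each other.
  compose : ∀ {x y z a b c} → D x y a b → D y z a c → D x z a b ⊎ D x z a c
  compose {a = a} {b} {c} xy yz with join xy c | join yz b
  ... | inj₂ (ac , _) | _             = inj₂ (D-transˡ ac yz)
  ... | inj₁ _        | inj₂ (ab , _) = inj₁ (D-transˡ xy ab)
  ... | inj₁ (_ , cy) | inj₁ (by , _) = ⊥-elim (D2 (swapˡ (swapʳ cy)) (swapˡ (swapʳ by)))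

  separated : ∀ {x y a b c d} → D x y a b → ¬ D x c a b → ¬ D x d a b → D x y c d
  separated {c = c} {d} e ¬c ¬d with join e c | join e d
  ... | inj₁ (cx , _) | _             = ⊥-elim (¬c (swapˡ cx))
  ... | inj₂ _        | inj₁ (dx , _) = ⊥-elim (¬d (swapˡ dx))
  ... | inj₂ (ac , _) | inj₂ (ad , _) = D-transʳ (swapʳ ac) ad

  -- Cuts.

  record Cut : Set₁ where
    field
      In Out : Ω → Set
      side   : ∀ x → In x ⊎ Out x
      cut    : In w → In x → Out y → Out z → D w x y z

    exclusive : In x → Out x → ⊥
    exclusive i o = disjoint (cut i i o o) refl

    all-In : {A : Set} (f : A → Ω) → ¬ (∃[ a ] Out (f a)) → ∀ a → In (f a)
    all-In f none a with side (f a)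
    ... | inj₁ i = i
    ... | inj₂ o = ⊥-elim (none (a , o))

  -- Swapping the fields is enough because `Out` is a predicate of its own rather than the negation
  -- of `In`.
  opposite : Cut → Cut
  opposite C = record
    { In   = Out
    ; Out  = In
    ; side = λ x → Sum.swap (side x)
    ; cut  = λ o o′ i i′ → flip (cut i i′ o o′)
    }
    where open Cut C

  record Separates (C : Cut) (w x y z : Ω) : Set where
    open Cut C
    field
      in₁  : In w
      in₂  : In x
      out₁ : Out y
      out₂ : Out z

  -- By the symmetries of D one may assume i < j, k < l and i < k.
  module _ {J : Set} {_≺_ : J → J → Set} (cmp : Trichotomous _≡_ _≺_) (e : J → Ω)
           (none : ∀ {i j k l} → i ≺ j → j ≺ k → k ≺ l →
             ¬ D (e i) (e j) (e k) (e l) × ¬ D (e i) (e k) (e j) (e l) × ¬ D (e i) (e l) (e j) (e k))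
           where

    unrelated : ∀ i j k l → i ≢ j → i ≢ k → i ≢ l → j ≢ k → j ≢ l → k ≢ l →
                ¬ D (e i) (e j) (e k) (e l)
    unrelated i j k l i≢j i≢k i≢l j≢k j≢l k≢l = sort₁
      where
      sorted : ∀ {i j k l} → j ≢ k → j ≢ l → i ≺ j → k ≺ l → i ≺ k → ¬ D (e i) (e j) (e k) (e l)
      sorted {i} {j} {k} {l} j≢k j≢l i<j k<l i<k d with cmp j k | cmp j l
      ... | tri< j<k _ _ | _            = proj₁ (none i<j j<k k<l) d
      ... | tri≈ _ j≡k _ | _            = j≢k j≡k
      ... | tri> _ _ k<j | tri< j<l _ _ = proj₁ (proj₂ (none i<k k<j j<l)) d
      ... | tri> _ _ k<j | tri≈ _ j≡l _ = j≢l j≡l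
      ... | tri> _ _ k<j | tri> _ _ l<j = proj₂ (proj₂ (none i<k k<l l<j)) d

      sort₃ : ∀ {i j k l} → i ≢ k → i ≢ l → j ≢ k → j ≢ l → i ≺ j → k ≺ l → ¬ D (e i) (e j) (e k) (e l)
      sort₃ {i} {j} {k} {l} i≢k i≢l j≢k j≢l i<j k<l d with cmp i k
      ... | tri< i<k _ _ = sorted j≢k j≢l i<j k<l i<k d
      ... | tri≈ _ i≡k _ = i≢k i≡k
      ... | tri> _ _ k<i = sorted (≢-sym i≢l) (≢-sym j≢l) k<l i<j k<i (flip d)

      sort₂ : ∀ {i j k l} → i ≢ k → i ≢ l → j ≢ k → j ≢ l → k ≢ l → i ≺ j → ¬ D (e i) (e j) (e k) (e l)
      sort₂ {i} {j} {k} {l} i≢k i≢l j≢k j≢l k≢l i<j d with cmp k l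
      ... | tri< k<l _ _ = sort₃ i≢k i≢l j≢k j≢l i<j k<l d
      ... | tri≈ _ k≡l _ = k≢l k≡l
      ... | tri> _ _ l<k = sort₃ i≢l i≢k j≢l j≢k i<j l<k (swapʳ d)

      sort₁ : ¬ D (e i) (e j) (e k) (e l)
      sort₁ d with cmp i j
      ... | tri< i<j _ _ = sort₂ i≢k i≢l j≢k j≢l k≢l i<j d
      ... | tri≈ _ i≡j _ = i≢j i≡j
      ... | tri> _ _ j<i = sort₂ j≢k j≢l i≢k i≢l k≢l j<i (swapˡ d)

module Classical (em : ExcludedMiddle 0ℓ) (M : DStructure) where
  open DStructure M
  open DSet M

  -- The inner side consists of all v with wv|yz. A point outside it cannot join the left pair, so
  -- it joins y on the right.
  cutOf : ∀ {w x y z} → D w x y z → Σ Cut λ C → Separates C w x y z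
  cutOf {w} {x} {y} {z} d = C , record
    { in₁  = flip (D4 (≢-sym (disjoint d)) (≢-sym (disjointʳ d)))
    ; in₂  = d
    ; out₁ = λ e → disjoint (swapˡ e) refl
    ; out₂ = λ e → disjointʳ (swapˡ e) refl
    }
    where
    A : Ω → Set
    A v = D w v y z

    beyond : ∀ {a a′ u} → A a → A a′ → ¬ A u → D a a′ y u
    beyond {u = u} a a′ ¬u with join (D-transˡ (swapˡ a) a′) u
    ... | inj₁ (ua , _) = ⊥-elim (¬u (D-transˡ a (swapˡ ua)))
    ... | inj₂ (yu , _) = yu

    C : Cut
    C = record
      { In   = A
      ; Out  = λ v → ¬ A v
      ; side = λ v → side′ v em
      ; cut  = λ a a′ u u′ → D-transʳ (swapʳ (beyond a a′ u)) (beyond a a′ u′)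
      }
      where
      side′ : ∀ v → Dec (A v) → A v ⊎ ¬ A v
      side′ v (yes a) = inj₁ a
      side′ v (no ¬a) = inj₂ ¬a

  -- The node splitting determined by three points.

  module Median (I : LinOrder) (p q r : Ω) (p≢q : p ≢ q) (p≢r : p ≢ r) (q≢r : q ≢ r) where

    infix 4 _~_
    -- In the underlying tree p, q, r meet at one vertex. Two points lie on the same branch there
    -- iff a cut separates them from two of p, q, r.
    _~_ : Ω → Ω → Set
    x ~ y = D x y p q ⊎ D x y p r ⊎ D x y q r

    ~-refl : ∀ {x} → x ~ x
    ~-refl {x} with em {x ≡ p} | em {x ≡ q}
    ... | yes refl | _        = inj₂ (inj₂ (flip (D4 (≢-sym p≢q) (≢-sym p≢r))))
    ... | no _     | yes refl = inj₂ (inj₁ (flip (D4 p≢q (≢-sym q≢r))))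
    ... | no x≢p   | no x≢q   = inj₁ (flip (D4 (≢-sym x≢p) (≢-sym x≢q)))

    ~-sym : ∀ {x y} → x ~ y → y ~ x
    ~-sym (inj₁ d)        = inj₁ (swapˡ d)
    ~-sym (inj₂ (inj₁ d)) = inj₂ (inj₁ (swapˡ d))
    ~-sym (inj₂ (inj₂ d)) = inj₂ (inj₂ (swapˡ d))

    -- Any two of the pairs pq, pr, qr share a point. This is the common point that `compose` asks
    -- for when the two witnessing pairs differ.
    ~-trans : ∀ {x y z} → x ~ y → y ~ z → x ~ z
    ~-trans (inj₁ d) (inj₁ e) = inj₁ (D-transˡ d e)
    ~-trans (inj₂ (inj₁ d)) (inj₂ (inj₁ e)) = inj₂ (inj₁ (D-transˡ d e))
    ~-trans (inj₂ (inj₂ d)) (inj₂ (inj₂ e)) = inj₂ (inj₂ (D-transˡ d e))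
    ~-trans (inj₁ d) (inj₂ (inj₁ e)) with compose d e
    ... | inj₁ f = inj₁ f
    ... | inj₂ f = inj₂ (inj₁ f)
    ~-trans (inj₁ d) (inj₂ (inj₂ e)) with compose (swapʳ d) e
    ... | inj₁ f = inj₁ (swapʳ f)
    ... | inj₂ f = inj₂ (inj₂ f)
    ~-trans (inj₂ (inj₁ d)) (inj₁ e) with compose d e
    ... | inj₁ f = inj₂ (inj₁ f)
    ... | inj₂ f = inj₁ f
    ~-trans (inj₂ (inj₁ d)) (inj₂ (inj₂ e)) with compose (swapʳ d) (swapʳ e)
    ... | inj₁ f = inj₂ (inj₁ (swapʳ f))
    ... | inj₂ f = inj₂ (inj₂ (swapʳ f))
    ~-trans (inj₂ (inj₂ d)) (inj₁ e) with compose d (swapʳ e)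
    ... | inj₁ f = inj₂ (inj₂ f)
    ... | inj₂ f = inj₁ (swapʳ f)
    ~-trans (inj₂ (inj₂ d)) (inj₂ (inj₁ e)) with compose (swapʳ d) (swapʳ e)
    ... | inj₁ f = inj₂ (inj₂ (swapʳ f))
    ... | inj₂ f = inj₂ (inj₁ (swapʳ f))

    ~-splitI : ∀ {x y c d} → x ~ y → ¬ (x ~ c) → ¬ (x ~ d) → D x y c d
    ~-splitI (inj₁ e) x≁c x≁d =
      separated e (λ f → x≁c (inj₁ f)) (λ f → x≁d (inj₁ f))
    ~-splitI (inj₂ (inj₁ e)) x≁c x≁d =
      separated e (λ f → x≁c (inj₂ (inj₁ f))) (λ f → x≁d (inj₂ (inj₁ f)))
    ~-splitI (inj₂ (inj₂ e)) x≁c x≁d =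
      separated e (λ f → x≁c (inj₂ (inj₂ f))) (λ f → x≁d (inj₂ (inj₂ f)))

    -- Two of p, q, r lie on the same side of a b | c d.
    ~-splitII : ∀ {a b c d} → ¬ (a ~ b) → ¬ (c ~ d) → ¬ D a b c d
    ~-splitII {a} {b} {c} {d} a≁b c≁d e with join e p | join e q | join e r
    ... | inj₁ (pa , _) | inj₁ (qa , _) | _ = c≁d (inj₁ (flip (D-transˡ pa (swapˡ qa))))
    ... | inj₁ (pa , _) | _ | inj₁ (ra , _) = c≁d (inj₂ (inj₁ (flip (D-transˡ pa (swapˡ ra)))))
    ... | _ | inj₁ (qa , _) | inj₁ (ra , _) = c≁d (inj₂ (inj₂ (flip (D-transˡ qa (swapˡ ra)))))
    ... | inj₂ (cp , _) | inj₂ (cq , _) | _ = a≁b (inj₁ (D-transʳ (swapʳ cp) cq))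
    ... | inj₂ (cp , _) | _ | inj₂ (cr , _) = a≁b (inj₂ (inj₁ (D-transʳ (swapʳ cp) cr)))
    ... | _ | inj₂ (cq , _) | inj₂ (cr , _) = a≁b (inj₂ (inj₂ (D-transʳ (swapʳ cq) cr)))

    p≁q : ¬ (p ~ q)
    p≁q (inj₁ d)        = disjoint d refl
    p≁q (inj₂ (inj₁ d)) = disjoint d refl
    p≁q (inj₂ (inj₂ d)) = disjoint (swapˡ d) refl

    p≁r : ¬ (p ~ r)
    p≁r (inj₁ d)        = disjoint d refl
    p≁r (inj₂ (inj₁ d)) = disjoint d refl
    p≁r (inj₂ (inj₂ d)) = disjointʳ (swapˡ d) refl

    q≁r : ¬ (q ~ r)
    q≁r (inj₁ d)        = disjointʳ d refl
    q≁r (inj₂ (inj₁ d)) = disjointʳ (swapˡ d) refl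
    q≁r (inj₂ (inj₂ d)) = disjoint d refl

    splitting : Splitting M I
    splitting = record
      { _~_      = _~_
      ; isEq     = record { refl = ~-refl ; sym = ~-sym ; trans = ~-trans }
      ; twoParts = p , q , p≁q
      ; splitI   = ~-splitI
      ; splitII  = λ a≁b _ _ _ _ c≁d → ~-splitII a≁b c≁d
      }

    isNode : NodeSplitting M I splitting
    isNode = p , q , r , p≁q , p≁r , q≁r

  -- Order-types and sequences

  module Sequences (I : LinOrder) where
    open LinOrder I
    open IsStrictTotalOrder isSTO public using (compare; irrefl; asym) renaming (trans to <-trans)

    apart : ∀ {a : Idx → Ω} {i j} → PairwiseDistinct M I a → i < j → a i ≢ a j
    apart distinct i<j = distinct _ _ λ i≡j → irrefl i≡j i<j

    increasing-lookup : {is : List Idx} → Linked _<_ is → Increasing M I (lookup is)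
    increasing-lookup l = lookup-AllPairs (Linked⇒AllPairs <-trans l)

    -- The domain is arbitrary and coincidences are allowed, so that unsorted tuples with
    -- repetitions are covered; one case distinction informs about f and g together.
    SameOrder : {A : Set} (f g : A → Idx) → Set
    SameOrder f g = ∀ a b → (f a < f b × g a < g b) ⊎ (f a ≡ f b × g a ≡ g b) ⊎ (f b < f a × g b < g a)

    increasing⇒sameOrder : ∀ {m} {ι κ : Fin m → Idx} →
                           Increasing M I ι → Increasing M I κ → SameOrder ι κ
    increasing⇒sameOrder incι incκ a b with Fin.<-cmp a b
    ... | tri< a<b _ _  = inj₁ (incι a b a<b , incκ a b a<b)
    ... | tri≈ _ refl _ = inj₂ (inj₁ (refl , refl))
    ... | tri> _ _ b<a  = inj₂ (inj₂ (incι b a b<a , incκ b a b<a))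

    module _ {A : Set} {f g : A → Idx} (same : SameOrder f g) where

      sameOrder-< : ∀ {a b} → f a < f b → g a < g b
      sameOrder-< {a} {b} fa<fb with same a b
      ... | inj₁ (_ , ga<gb)        = ga<gb
      ... | inj₂ (inj₁ (fa≡fb , _)) = ⊥-elim (irrefl fa≡fb fa<fb)
      ... | inj₂ (inj₂ (fb<fa , _)) = ⊥-elim (asym fa<fb fb<fa)

      sameOrder-≡ : ∀ {a b} → f a ≡ f b → g a ≡ g b
      sameOrder-≡ {a} {b} fa≡fb with same a b
      ... | inj₁ (fa<fb , _)        = ⊥-elim (irrefl fa≡fb fa<fb)
      ... | inj₂ (inj₁ (_ , ga≡gb)) = ga≡gb
      ... | inj₂ (inj₂ (fb<fa , _)) = ⊥-elim (irrefl (sym fa≡fb) fb<fa)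

    -- Sorting, and transfer between tuples of the same order type.

    module Insertion {A : Set} (f : A → Idx) where

      _≺_ : A → A → Set
      a ≺ b = f a < f b

      insert : A → List A → List A
      insert a []       = a ∷ []
      insert a (b ∷ bs) with compare (f a) (f b)
      ... | tri< _ _ _ = a ∷ b ∷ bs
      ... | tri≈ _ _ _ = b ∷ bs
      ... | tri> _ _ _ = b ∷ insert a bs

      insert-All : {P : A → Set} → ∀ {a bs} → P a → All P bs → All P (insert a bs)
      insert-All {bs = []} pa _ = pa ∷ []
      insert-All {a = a} {b ∷ _} pa (pb ∷ pbs) with compare (f a) (f b)
      ... | tri< _ _ _ = pa ∷ pb ∷ pbs
      ... | tri≈ _ _ _ = pb ∷ pbs
      ... | tri> _ _ _ = pb ∷ insert-All pa pbs

      insert-sorted : ∀ a {bs} → AllPairs _≺_ bs → AllPairs _≺_ (insert a bs)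
      insert-sorted a [] = [] ∷ []
      insert-sorted a {b ∷ _} (pb ∷ pbs) with compare (f a) (f b)
      ... | tri< a<b _ _ = (a<b ∷ All.map (<-trans a<b) pb) ∷ pb ∷ pbs
      ... | tri≈ _ _ _   = pb ∷ pbs
      ... | tri> _ _ b<a = insert-All b<a pb ∷ insert-sorted a pbs

      -- `insert` drops an element whose value under f is present already, so only the value can be
      -- found again in the list, not the element.
      Represented : A → List A → Set
      Represented a = Any (λ b → f b ≡ f a)

      insert-new : ∀ a bs → Represented a (insert a bs)
      insert-new a []       = here refl
      insert-new a (b ∷ bs) with compare (f a) (f b)
      ... | tri< _ _ _ = here refl
      ... | tri≈ _ e _ = here (sym e)
      ... | tri> _ _ _ = there (insert-new a bs)

      insert-old : ∀ a {c bs} → Represented c bs → Represented c (insert a bs)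
      insert-old a {bs = b ∷ bs} r with compare (f a) (f b)
      ... | tri< _ _ _ = there r
      ... | tri≈ _ _ _ = r
      insert-old a {bs = b ∷ bs} (here e)  | tri> _ _ _ = here e
      insert-old a {bs = b ∷ bs} (there r) | tri> _ _ _ = there (insert-old a r)

    module Indisc {n : ℕ} (s : Idx → Fin n → Ω) (ind : Indiscernible M I s) where

      move-increasing : ∀ {m} {ι κ : Fin m → Idx} → Increasing M I ι → Increasing M I κ →
        ∀ (t₁ t₂ t₃ t₄ : Fin m × Fin n) →
        let ev = λ (f : Fin m → Idx) (t : Fin m × Fin n) → s (f (proj₁ t)) (proj₂ t) in
        D (ev ι t₁) (ev ι t₂) (ev ι t₃) (ev ι t₄) → D (ev κ t₁) (ev κ t₂) (ev κ t₃) (ev κ t₄)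
      move-increasing {m} incι incκ t₁ t₂ t₃ t₄ =
        Equivalence.to (ind m 4 (relD 0F 1F 2F 3F) (lookup (t₁ ∷ t₂ ∷ t₃ ∷ t₄ ∷ [])) _ _ incι incκ)

      -- Indiscernibility speaks of increasing tuples only. The four elements are sorted by f
      -- without repetition, and the resulting list is increasing under g too. An element and its
      -- representative agree under f, hence under g.
      move : {A : Set} {f g : A → Idx} → SameOrder f g → ∀ (t₁ t₂ t₃ t₄ : A × Fin n) →
        let ev = λ (h : A → Idx) (t : A × Fin n) → s (h (proj₁ t)) (proj₂ t) in
        D (ev f t₁) (ev f t₂) (ev f t₃) (ev f t₄) → D (ev g t₁) (ev g t₂) (ev g t₃) (ev g t₄)
      move {A} {f} {g} same (a₁ , c₁) (a₂ , c₂) (a₃ , c₃) (a₄ , c₄) d =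
        D-cong (g-rep r₁) (g-rep r₂) (g-rep r₃) (g-rep r₄)
          (move-increasing (lookup-AllPairs sorted)
            (λ p q p<q → sameOrder-< same (lookup-AllPairs sorted p q p<q))
            (Any.index r₁ , c₁) (Any.index r₂ , c₂) (Any.index r₃ , c₃) (Any.index r₄ , c₄)
            (D-cong (sym (f-rep r₁)) (sym (f-rep r₂)) (sym (f-rep r₃)) (sym (f-rep r₄)) d))
        where
        open Insertion f
        L₁ L₂ L₃ L : List A
        L₁ = insert a₁ []
        L₂ = insert a₂ L₁
        L₃ = insert a₃ L₂
        L  = insert a₄ L₃
        r₁ : Represented a₁ L
        r₁ = insert-old a₄ (insert-old a₃ (insert-old a₂ (insert-new a₁ [])))
        r₂ : Represented a₂ L
        r₂ = insert-old a₄ (insert-old a₃ (insert-new a₂ L₁))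
        r₃ : Represented a₃ L
        r₃ = insert-old a₄ (insert-new a₃ L₂)
        r₄ : Represented a₄ L
        r₄ = insert-new a₄ L₃
        sorted : AllPairs _≺_ L
        sorted = insert-sorted a₄ (insert-sorted a₃ (insert-sorted a₂ (insert-sorted a₁ [])))
        f-rep : ∀ {a c} (r : Represented a L) → s (f (lookup L (Any.index r))) c ≡ s (f a) c
        f-rep {c = c} r = cong (λ i → s i c) (lookup-index r)
        g-rep : ∀ {a c} (r : Represented a L) → s (g (lookup L (Any.index r))) c ≡ s (g a) c
        g-rep {c = c} r = cong (λ i → s i c) (sameOrder-≡ same (lookup-index r))

    -- The two ends of the index order.

    data End : Set where
      lo hi : End

    -- The order read towards the end ε, so that arguments are made once for both ends.
    _<[_]_ : Idx → End → Idx → Set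
    i <[ lo ] j = j < i
    i <[ hi ] j = i < j

    <[]-irrefl : ∀ ε {i} → ¬ (i <[ ε ] i)
    <[]-irrefl lo = irrefl refl
    <[]-irrefl hi = irrefl refl

    <[]-asym : ∀ ε {i j} → i <[ ε ] j → ¬ (j <[ ε ] i)
    <[]-asym lo = asym
    <[]-asym hi = asym

    <[]-trans : ∀ ε {i j k} → i <[ ε ] j → j <[ ε ] k → i <[ ε ] k
    <[]-trans lo p q = <-trans q p
    <[]-trans hi p q = <-trans p q

    <[]-compare : ∀ ε i j → i <[ ε ] j ⊎ i ≡ j ⊎ j <[ ε ] i
    <[]-compare ε i j with compare i j
    <[]-compare lo i j | tri< i<j _ _ = inj₂ (inj₂ i<j)
    <[]-compare hi i j | tri< i<j _ _ = inj₁ i<j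
    <[]-compare ε  i j | tri≈ _ i≡j _ = inj₂ (inj₁ i≡j)
    <[]-compare lo i j | tri> _ _ j<i = inj₁ j<i
    <[]-compare hi i j | tri> _ _ j<i = inj₂ (inj₂ j<i)

    module _ (unb : Unbounded I) where

      next : ∀ ε i → ∃[ j ] (i <[ ε ] j)
      next lo = proj₁ unb
      next hi = proj₂ unb

      next₂ : ∀ ε i j → ∃[ k ] (i <[ ε ] k × j <[ ε ] k)
      next₂ ε i j with <[]-compare ε i j | next ε i | next ε j
      ... | inj₁ i<j         | _       | k , j<k = k , <[]-trans ε i<j j<k , j<k
      ... | inj₂ (inj₁ refl) | _       | k , j<k = k , j<k , j<k
      ... | inj₂ (inj₂ j<i)  | k , i<k | _       = k , i<k , <[]-trans ε j<i i<k

      bound : ∀ ε i {m} (ι : Fin m → Idx) → ∃[ k ] (i <[ ε ] k × (∀ p → ι p <[ ε ] k))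
      bound ε i {ℕ.zero} ι = let k , i<k = next ε i in k , i<k , λ ()
      bound ε i {ℕ.suc m} ι =
        let j , i<j , ι<j = bound ε i (λ p → ι (Fin.suc p))
            k , j<k , ι₀<k = next₂ ε j (ι Fin.zero)
        in k , <[]-trans ε i<j j<k ,
           λ { Fin.zero → ι₀<k ; (Fin.suc p) → <[]-trans ε (ι<j p) j<k }

    -- Far indices that ι and κ share, so that adjoining them preserves the order type. Each end
    -- carries two, since `Limit` takes two different terms on the side away from b. The index i₀
    -- will be one at which a component crosses the cut.
    record Frame {m} (ι κ : Fin m → Idx) (i₀ : Idx) : Set where
      field
        E        : End → Bool → Idx
        distinct : ∀ ε → E ε false ≢ E ε true
        base<    : ∀ ε x → i₀ <[ ε ] E ε x
        ι<       : ∀ ε x p → ι p <[ ε ] E ε x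
        κ<       : ∀ ε x p → κ p <[ ε ] E ε x

      place : (Fin m → Idx) → Fin m ⊎ (End × Bool) → Idx
      place f (inj₁ p)       = f p
      place f (inj₂ (ε , x)) = E ε x

      place-sameOrder : SameOrder ι κ → SameOrder (place ι) (place κ)
      place-sameOrder same (inj₁ p) (inj₁ q) = same p q
      place-sameOrder same (inj₁ p) (inj₂ (lo , x)) = inj₂ (inj₂ (ι< lo x p , κ< lo x p))
      place-sameOrder same (inj₁ p) (inj₂ (hi , x)) = inj₁ (ι< hi x p , κ< hi x p)
      place-sameOrder same (inj₂ (lo , x)) (inj₁ p) = inj₁ (ι< lo x p , κ< lo x p)
      place-sameOrder same (inj₂ (hi , x)) (inj₁ p) = inj₂ (inj₂ (ι< hi x p , κ< hi x p))
      place-sameOrder same (inj₂ (ε , x)) (inj₂ (ε′ , x′)) with compare (E ε x) (E ε′ x′)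
      ... | tri< l _ _ = inj₁ (l , l)
      ... | tri≈ _ e _ = inj₂ (inj₁ (e , e))
      ... | tri> _ _ g = inj₂ (inj₂ (g , g))

      same-end : ∀ ε ε′ {x p} → κ p <[ ε ] E ε′ x → ε ≡ ε′
      same-end lo lo _ = refl
      same-end hi hi _ = refl
      same-end lo hi {x} {p} l = ⊥-elim (asym l (κ< hi x p))
      same-end hi lo {x} {p} l = ⊥-elim (asym l (κ< lo x p))

    frame : Unbounded I → ∀ {m} (ι κ : Fin m → Idx) i₀ → Frame ι κ i₀
    frame unb ι κ i₀ = record
      { E        = E
      ; distinct = λ ε e → <[]-irrefl ε (subst (E ε false <[ ε ]_) (sym e) (near<far ε))
      ; base<    = λ ε x → beyond ε x (<[]-trans ε (base<j ε) (j<near ε))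
      ; ι<       = λ ε x p → beyond ε x (ι<near ε p)
      ; κ<       = λ ε x p → beyond ε x (<[]-trans ε (κ<j ε p) (j<near ε))
      }
      where
      boundκ : ∀ ε → _
      boundκ ε = bound unb ε i₀ κ
      boundι : ∀ ε → _
      boundι ε = bound unb ε (proj₁ (boundκ ε)) ι
      E : End → Bool → Idx
      E ε false = proj₁ (boundι ε)
      E ε true  = proj₁ (next unb ε (proj₁ (boundι ε)))
      near<far : ∀ ε → E ε false <[ ε ] E ε true
      near<far ε = proj₂ (next unb ε (E ε false))
      base<j : ∀ ε → i₀ <[ ε ] proj₁ (boundκ ε)
      base<j ε = proj₁ (proj₂ (boundκ ε))
      κ<j : ∀ ε p → κ p <[ ε ] proj₁ (boundκ ε)
      κ<j ε = proj₂ (proj₂ (boundκ ε))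
      j<near : ∀ ε → proj₁ (boundκ ε) <[ ε ] E ε false
      j<near ε = proj₁ (proj₂ (boundι ε))
      ι<near : ∀ ε p → ι p <[ ε ] E ε false
      ι<near ε = proj₂ (proj₂ (boundι ε))
      beyond : ∀ ε x {i} → i <[ ε ] E ε false → i <[ ε ] E ε x
      beyond ε false l = l
      beyond ε true  l = <[]-trans ε l (near<far ε)

    -- Limits of a sequence.

    -- b behaves towards every cut splitting a like the terms of a near the end ε
    -- (see `limit`).
    Limit : End → Ω → (Idx → Ω) → Set
    Limit ε b a = ∀ {i k m} → i ≢ k → D (a i) (a k) (a m) b → (i <[ ε ] m) × (k <[ ε ] m)

    -- If the k-th term were inside, the cut would give aᵢaₖ|aₘb, and `Limit` would put m beyond k
    -- towards ε.
    limit : ∀ ε {b a} (C : Cut) → let open Cut C in Limit ε b a → Out b →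
            ∀ {i m k} → In (a i) → Out (a m) → i <[ ε ] k → m <[ ε ] k → Out (a k)
    limit ε {b} {a} C lim b-out {i} {m} {k} i-in m-out i<k m<k with Cut.side C (a k)
    ... | inj₂ k-out = k-out
    ... | inj₁ k-in  = ⊥-elim (<[]-asym ε m<k (proj₂ (lim i≢k (Cut.cut C i-in k-in m-out b-out))))
      where
      i≢k : i ≢ k
      i≢k refl = <[]-irrefl ε i<k

    Limit-from-< : ∀ ε {b a} →
      (∀ {i k m} → i < k → D (a i) (a k) (a m) b → (i <[ ε ] m) × (k <[ ε ] m)) → Limit ε b a
    Limit-from-< _ h {i} {k} i≢k d with compare i k
    ... | tri< i<k _ _ = h i<k d
    ... | tri≈ _ i≡k _ = ⊥-elim (i≢k i≡k)
    ... | tri> _ _ k<i = swap (h k<i (swapˡ d))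

    index-of : ∀ {e₁ e₂ e₃ e₄ p} → In4 M I p e₁ e₂ e₃ e₄ → ∃[ α ] p ≡ lookup (e₁ ∷ e₂ ∷ e₃ ∷ e₄ ∷ []) α
    index-of (inj₁ e)               = 0F , e
    index-of (inj₂ (inj₁ e))        = 1F , e
    index-of (inj₂ (inj₂ (inj₁ e))) = 2F , e
    index-of (inj₂ (inj₂ (inj₂ e))) = 3F , e

    -- Listing the points over `Fin 4` makes `unrelated` applicable; its only increasing quadruple
    -- gives the three pairings.
    noDAmong : ∀ {e₁ e₂ e₃ e₄} → ¬ D e₁ e₂ e₃ e₄ → ¬ D e₁ e₃ e₂ e₄ → ¬ D e₁ e₄ e₂ e₃ →
               NoDAmong M I e₁ e₂ e₃ e₄
    noDAmong {e₁} {e₂} {e₃} {e₄} n₁ n₂ n₃ _ _ _ _ p∈ q∈ r∈ u∈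
      with index-of p∈ | index-of q∈ | index-of r∈ | index-of u∈
    ... | α , refl | β , refl | γ , refl | δ , refl = λ p≢q p≢r p≢u q≢r q≢u r≢u →
      unrelated Fin.<-cmp e none α β γ δ
        (λ { refl → p≢q refl }) (λ { refl → p≢r refl }) (λ { refl → p≢u refl })
        (λ { refl → q≢r refl }) (λ { refl → q≢u refl }) (λ { refl → r≢u refl })
      where
      e : Fin 4 → Ω
      e = lookup (e₁ ∷ e₂ ∷ e₃ ∷ e₄ ∷ [])
      none : ∀ {i j k l} → i Fin.< j → j Fin.< k → k Fin.< l →
             ¬ D (e i) (e j) (e k) (e l) × ¬ D (e i) (e k) (e j) (e l) × ¬ D (e i) (e l) (e j) (e k)
      none i<j j<k k<l with increasing-Fin4 _ _ _ _ i<j j<k k<l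
      ... | refl , refl , refl , refl = n₁ , n₂ , n₃

    -- A nonconstant component is petaled or monotonic.

    module Component {n : ℕ} (s : Idx → Fin n → Ω) (unb : Unbounded I) (ind : Indiscernible M I s) (c : Fin n) where
      open Indisc s ind

      private
        a : Idx → Ω
        a i = s i c

        above : ∀ i → ∃[ j ] (i < j)
        above = proj₂ unb

      move₄ : ∀ {i j k l i′ j′ k′ l′} → i < j → j < k → k < l → i′ < j′ → j′ < k′ → k′ < l′ →
              ∀ (α β γ δ : Fin 4) →
              let f = lookup (i ∷ j ∷ k ∷ l ∷ [])
                  g = lookup (i′ ∷ j′ ∷ k′ ∷ l′ ∷ []) in
              D (a (f α)) (a (f β)) (a (f γ)) (a (f δ)) → D (a (g α)) (a (g β)) (a (g γ)) (a (g δ))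
      move₄ i<j j<k k<l i<j′ j<k′ k<l′ α β γ δ =
        move-increasing (increasing-lookup (i<j ∷ j<k ∷ k<l ∷ [-]))
                        (increasing-lookup (i<j′ ∷ j<k′ ∷ k<l′ ∷ [-])) (α , c) (β , c) (γ , c) (δ , c)

      private
        -- The inequality is carried by the relation aᵢaᵢ|aⱼaⱼ; the further indices only complete
        -- increasing quadruples.
        distinct-< : ∀ {i j i′ j′} → i < j → i′ < j′ → a i ≢ a j → a i′ ≢ a j′
        distinct-< {j = j} {j′ = j′} i<j i<j′ ne =
          let k , j<k = above j ; l , k<l = above k
              k′ , j<k′ = above j′ ; l′ , k<l′ = above k′
          in disjoint (move₄ i<j j<k k<l i<j′ j<k′ k<l′ 0F 0F 1F 1F (D4 ne ne))

        distinct : ∀ {i j} → i < j → a i ≢ a j → PairwiseDistinct M I a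
        distinct i<j ne i′ j′ i≢j with compare i′ j′
        ... | tri< i<j′ _ _ = distinct-< i<j i<j′ ne
        ... | tri≈ _ i≡j _  = ⊥-elim (i≢j i≡j)
        ... | tri> _ _ j<i′ = ≢-sym (distinct-< i<j j<i′ ne)

      nonconstant⇒distinct : ∀ {i j} → a i ≢ a j → PairwiseDistinct M I a
      nonconstant⇒distinct {i} {j} ne with compare i j
      ... | tri< i<j _ _  = distinct i<j ne
      ... | tri≈ _ refl _ = ⊥-elim (ne refl)
      ... | tri> _ _ j<i  = distinct j<i (≢-sym ne)

      -- All increasing quadruples have the same pairings. A fifth term refutes 13|24 and 14|23:
      -- whichever side it joins, some quadruple containing it gets a pairing other than the
      -- transferred one. What remains is 12|34, the monotonic case, or no pairing at all.
      petaled⊎monotonic : ∀ {i j} → a i ≢ a j → Petaled M I a ⊎ Monotonic M I a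
      petaled⊎monotonic {i₁} ne =
        let i₂ , i₁<i₂ = above i₁ ; i₃ , i₂<i₃ = above i₂
            i₄ , i₃<i₄ = above i₃ ; i₅ , i₄<i₅ = above i₄
        in classify i₁<i₂ i₂<i₃ i₃<i₄ i₄<i₅ em em em
        where
        classify : ∀ {i₁ i₂ i₃ i₄ i₅} → i₁ < i₂ → i₂ < i₃ → i₃ < i₄ → i₄ < i₅ →
                   Dec (D (a i₁) (a i₂) (a i₃) (a i₄)) → Dec (D (a i₁) (a i₃) (a i₂) (a i₄)) →
                   Dec (D (a i₁) (a i₄) (a i₂) (a i₃)) → Petaled M I a ⊎ Monotonic M I a
        classify p q r t (yes d) _ _ = inj₂
          ( nonconstant⇒distinct ne
          , λ _ _ _ _ i<j j<k k<l → move₄ p q r i<j j<k k<l 0F 1F 2F 3F d )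
        classify {i₅ = i₅} p q r t (no _) (yes d) _ with join d (a i₅)
        ... | inj₁ (d₅₁₂₄ , _) =
          ⊥-elim (D2 (swapʳ (move₄ p q r p (<-trans q r) t 0F 2F 1F 3F d)) (swapˡ (swapʳ d₅₁₂₄)))
        ... | inj₂ (_ , d₁₃₄₅) =
          ⊥-elim (D2 d₁₃₄₅ (move₄ p q r (<-trans p q) r t 0F 2F 1F 3F d))
        classify {i₅ = i₅} p q r t (no _) (no _) (yes d) with join d (a i₅)
        ... | inj₁ (_ , d₅₄₂₃) =
          ⊥-elim (D2 d₅₄₂₃ (swapˡ (swapʳ (move₄ p q r q r t 0F 3F 1F 2F d))))
        ... | inj₂ (d₁₄₂₅ , _) =
          ⊥-elim (D2 (swapʳ d₁₄₂₅) (swapʳ (move₄ p q r p (<-trans q r) t 0F 3F 1F 2F d)))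
        classify p q r t (no ¬d) (no ¬e) (no ¬f) = inj₁
          ( nonconstant⇒distinct ne
          , unrelated compare a λ i<j j<k k<l →
                (λ d → ¬d (move₄ i<j j<k k<l p q r 0F 1F 2F 3F d))
              , (λ d → ¬e (move₄ i<j j<k k<l p q r 0F 2F 1F 3F d))
              , (λ d → ¬f (move₄ i<j j<k k<l p q r 0F 3F 1F 2F d)) )

    -- The premise of `Limit` never occurs, so either end would do: aᵢaₖ|aₘb puts b into the sector
    -- of aₘ at the node of aᵢ, aₖ, aₘ, and that splitting separates all terms of a because a is
    -- petaled.
    petaled⇒limit : ∀ {a b} → Petaled M I a → ¬ PetalHull M I a b → Limit hi b a
    petaled⇒limit {a} {b} (distinct , noD) ¬hull {i} {k} {m} i≢k d = ⊥-elim (¬hull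
      ( splitting , isNode , extends , m , inj₁ (flip (swapʳ d)) ))
      where
      i≢m : i ≢ m
      i≢m refl = disjoint d refl
      k≢m : k ≢ m
      k≢m refl = disjoint (swapˡ d) refl
      open Median I (a i) (a k) (a m) (distinct i k i≢k) (distinct i m i≢m) (distinct k m k≢m)

      no-pair : ∀ {j l p q} → p ≢ q → j ≢ l → ¬ D (a j) (a l) (a p) (a q)
      no-pair {j} {l} {p} {q} p≢q j≢l e = noD j l p q j≢l
        (λ { refl → disjoint e refl }) (λ { refl → disjointʳ e refl })
        (λ { refl → disjoint (swapˡ e) refl }) (λ { refl → disjointʳ (swapˡ e) refl }) p≢q e

      extends : ExtendsSingletons M I splitting a
      extends j l j~l with em {j ≡ l} | j~l
      ... | yes refl | _             = refl
      ... | no j≢l | inj₁ e          = ⊥-elim (no-pair i≢k j≢l e)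
      ... | no j≢l | inj₂ (inj₁ e)   = ⊥-elim (no-pair i≢m j≢l e)
      ... | no j≢l | inj₂ (inj₂ e)   = ⊥-elim (no-pair k≢m j≢l e)

    -- Points outside the hull of a monotonic sequence.

    module _ {a : Idx → Ω} {b : Ω} (unb : Unbounded I) (mono : Monotonic M I a) (¬hull : ¬ MonoHull M I a b) where

      private
        dmono : ∀ {i j k l} → i < j → j < k → k < l → D (a i) (a j) (a k) (a l)
        dmono = proj₂ mono _ _ _ _

        -- The terms hang in order along a path of the tree. The point b branches off this path
        -- after aⱼ or before it.
        After Before : Idx → Set
        After  j = ∀ {i k} → i < j → j < k → D (a i) (a j) (a k) b
        Before j = ∀ {i k} → i < j → j < k → D (a i) b (a j) (a k)

        -- Of the three pairings `H₁` excludes aᵢaₖ|aⱼb, and `H₂` excludes that none holds.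
        three : ∀ {i j k} → i < j → j < k → D (a i) (a j) (a k) b ⊎ D (a i) b (a j) (a k)
        three {i} {j} {k} i<j j<k with em {D (a i) (a j) (a k) b} | em {D (a i) b (a j) (a k)}
        ... | yes d | _     = inj₁ d
        ... | no _  | yes d = inj₂ d
        ... | no ¬d | no ¬e = ⊥-elim (¬hull (inj₂ (inj₂ (inj₁ (i , j , k , i<j , j<k ,
          noDAmong ¬d (λ f → ¬hull (inj₂ (inj₁ (i , j , k , i<j , j<k , f)))) ¬e)))))

        moveʳ : ∀ {i j k l} → i < j → j < k → j < l → D (a i) (a j) (a k) b → D (a i) (a j) (a l) b
        moveʳ {k = k} {l} i<j j<k j<l d with compare k l
        ... | tri< k<l _ _  = D-transʳ (swapʳ (dmono i<j j<k k<l)) d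
        ... | tri≈ _ refl _ = d
        ... | tri> _ _ l<k  = D-transʳ (dmono i<j j<l l<k) d

        moveˡ : ∀ {h i j k} → h < j → i < j → j < k → D (a i) b (a j) (a k) → D (a h) b (a j) (a k)
        moveˡ {h} {i} h<j i<j j<k d with compare h i
        ... | tri< h<i _ _  = D-transˡ (dmono h<i i<j j<k) d
        ... | tri≈ _ refl _ = d
        ... | tri> _ _ i<h  = D-transˡ (swapˡ (dmono i<h h<j j<k)) d

        clash : ∀ {i j k} → D (a i) (a j) (a k) b → ¬ D (a i) b (a j) (a k)
        clash d = D2 (swapʳ d)

        -- The alternative in `three` depends on j alone: `moveʳ` and `moveˡ` change the flanking
        -- indices, and the two alternatives clash on equal indices.
        after⊎before : ∀ j → After j ⊎ Before j
        after⊎before j with proj₁ unb j | proj₂ unb j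
        ... | i₀ , i₀<j | k₀ , j<k₀ with three i₀<j j<k₀
        ...   | inj₁ d = inj₁ after
          where
          after : After j
          after i<j j<k with three i<j j<k
          ... | inj₁ e = e
          ... | inj₂ e = ⊥-elim (clash (moveʳ i₀<j j<k₀ j<k d) (moveˡ i₀<j i<j j<k e))
        ...   | inj₂ d = inj₂ before
          where
          before : Before j
          before i<j j<k with three i<j j<k
          ... | inj₂ e = e
          ... | inj₁ e = ⊥-elim (clash (moveʳ i<j j<k j<k₀ e) (moveˡ i<j i₀<j j<k₀ d))

        -- If b branches off after aⱼ and before aₖ, then j < k puts b into `H₃`, while k < j yields
        -- a pairing that monotonicity forbids.
        after-all : ∀ {j} → After j → ∀ k → After k
        after-all {j} after k with compare j k | after⊎before k
        ... | _            | inj₁ after′ = after′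
        ... | tri≈ _ refl _ | _          = after
        ... | tri< j<k _ _ | inj₂ before =
          let i , i<j = proj₁ unb j ; l , k<l = proj₂ unb k
          in ⊥-elim (¬hull (inj₂ (inj₂ (inj₂ (i , j , k , l , i<j , j<k , k<l ,
               before (<-trans i<j j<k) k<l , swapʳ (after i<j (<-trans j<k k<l)))))))
        ... | tri> _ _ k<j | inj₂ before =
          let i , i<k = proj₁ unb k ; l , j<l = proj₂ unb j
          in ⊥-elim (D2 (swapʳ (dmono i<k k<j j<l))
               (D-transˡ (before i<k k<j) (swapˡ (flip (after k<j j<l)))))

      -- By `after-all`, b lies after every term or before every term. Then any other position of m
      -- contradicts the known pairing of b with the three terms.
      monotonic⇒limit : ∃[ ε ] Limit ε b a
      monotonic⇒limit with em {∃[ j ] After j}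
      ... | yes (j , after) = hi , Limit-from-< hi at-hi
        where
        all : ∀ k → After k
        all = after-all after
        at-hi : ∀ {i k m} → i < k → D (a i) (a k) (a m) b → (i < m) × (k < m)
        at-hi {i} {k} {m} i<k d with compare m k | compare i m
        ... | tri> _ _ k<m  | _             = <-trans i<k k<m , k<m
        ... | tri≈ _ refl _ | _             = ⊥-elim (disjoint (swapˡ d) refl)
        ... | tri< m<k _ _  | tri< i<m _ _  = ⊥-elim (D2 (all m i<m m<k) d)
        ... | tri< _ _ _    | tri≈ _ refl _ = ⊥-elim (disjoint d refl)
        ... | tri< _ _ _    | tri> _ _ m<i  = ⊥-elim (D2 (swapˡ (all i m<i i<k)) d)
      ... | no none = lo , Limit-from-< lo at-lo
        where
        all : ∀ k → Before k
        all k with after⊎before k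
        ... | inj₁ after  = ⊥-elim (none (k , after))
        ... | inj₂ before = before
        at-lo : ∀ {i k m} → i < k → D (a i) (a k) (a m) b → (m < i) × (m < k)
        at-lo {i} {k} {m} i<k d with compare m i | compare m k
        ... | tri< m<i _ _  | _             = m<i , <-trans m<i i<k
        ... | tri≈ _ refl _ | _             = ⊥-elim (disjoint d refl)
        ... | tri> _ _ i<m  | tri< m<k _ _  = ⊥-elim (D2 (swapʳ (all m i<m m<k)) (swapʳ d))
        ... | tri> _ _ _    | tri≈ _ refl _ = ⊥-elim (disjoint (swapˡ d) refl)
        ... | tri> _ _ _    | tri> _ _ k<m  = ⊥-elim (D2 (all k i<k k<m) (swapʳ d))

    module WeakIndiscernibility {n : ℕ} (s : Idx → Fin n → Ω) (unb : Unbounded I)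
                                (ind : Indiscernible M I s) (B : Ω → Set) where
      open Indisc s ind

      comp : Fin n → Idx → Ω
      comp c i = s i c

      -- Avoiding the hull is necessary

      module _ (weak : WeaklyIndiscernible M I s B) where

        weak₃ : ∀ {i j k i′ j′ k′} → i < j → j < k → i′ < j′ → j′ < k′ → ∀ (t₁ t₂ t₃ t₄ : Term M I 3 n B) →
          let ev  = evalT M I s (lookup (i ∷ j ∷ k ∷ []))
              ev′ = evalT M I s (lookup (i′ ∷ j′ ∷ k′ ∷ [])) in
          D (ev t₁) (ev t₂) (ev t₃) (ev t₄) → D (ev′ t₁) (ev′ t₂) (ev′ t₃) (ev′ t₄)
        weak₃ i<j j<k i<j′ j<k′ t₁ t₂ t₃ t₄ = Equivalence.to
          (weak 3 t₁ t₂ t₃ t₄ _ _ (increasing-lookup (i<j ∷ j<k ∷ [-])) (increasing-lookup (i<j′ ∷ j<k′ ∷ [-])))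

        module _ {b : Ω} (b∈B : B b) (c : Fin n) where

          private
            a : Idx → Ω
            a = comp c

            param x₀ x₁ x₂ : Term M I 3 n B
            param = inj₂ (b , b∈B)
            x₀ = inj₁ (0F , c)
            x₁ = inj₁ (1F , c)
            x₂ = inj₁ (2F , c)

          -- From b in the sector of aᵢ follows baᵢ|aⱼaₖ. Moving all three indices to later ones
          -- relates points of four different sectors.
          ∉petalHull : PairwiseDistinct M I a → ¬ PetalHull M I a b
          ∉petalHull distinct (S , _ , extends , i , b~aᵢ) =
            let j , i<j = proj₂ unb i ; k , j<k = proj₂ unb j ; l , k<l = proj₂ unb k
                i<k = <-trans i<j j<k ; i<l = <-trans i<k k<l
            in splitII (b≁ i<j) (b≁ i<k) (b≁ i<l) (≁ j<k) (≁ (<-trans j<k k<l)) (≁ k<l)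
                 (weak₃ i<j j<k j<k k<l param x₀ x₁ x₂ (splitI b~aᵢ (b≁ i<j) (b≁ i<k)))
            where
            open Splitting S
            open IsEquivalence isEq using () renaming (sym to ~-sym; trans to ~-trans)
            ≁ : ∀ {i j} → i < j → ¬ (a i ~ a j)
            ≁ {i} {j} i<j i~j = apart distinct i<j (extends i j i~j)
            b≁ : ∀ {j} → i < j → ¬ (b ~ a j)
            b≁ i<j b~aⱼ = ≁ i<j (~-trans (~-sym b~aᵢ) b~aⱼ)

          -- With b = aᵢ and h < i, the relation aₕaₕ|bb would move to aᵢaᵢ|bb.
          ∉range : PairwiseDistinct M I a → ∀ i → b ≢ a i
          ∉range distinct i refl =
            let h , h<i = proj₁ unb i ; j , i<j = proj₂ unb i ; k , j<k = proj₂ unb j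
                h≢i = apart distinct h<i
            in disjoint (weak₃ h<i i<j i<j j<k x₀ x₀ param param (D4 h≢i h≢i)) refl

          -- For `H₁` and `H₂` a later term l is added, and b joins a side of aᵢaⱼ|aₖaₗ. Either
          -- outcome, compared after a shift of indices if necessary, conflicts with the given
          -- pairing or with the absence of pairings. For `H₃`, moving k to j in the first relation
          -- contradicts the second.
          ∉monoHull : Monotonic M I a → ¬ MonoHull M I a b
          ∉monoHull (distinct , _) (inj₁ (i , b≡aᵢ)) = ∉range distinct i b≡aᵢ
          ∉monoHull (_ , mono) (inj₂ (inj₁ (i , j , k , i<j , j<k , d)))
            with proj₂ unb k
          ... | l , k<l with join (mono i j k l i<j j<k k<l) b
          ...   | inj₁ (_ , bj) = D2 (swapʳ (swapˡ bj)) (swapʳ (weak₃ i<j j<k j<k k<l x₀ x₂ x₁ param d))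
          ...   | inj₂ (kb , _) = D2 kb d
          ∉monoHull (distinct , mono) (inj₂ (inj₂ (inj₁ (i , j , k , i<j , j<k , none))))
            with proj₂ unb k
          ... | l , k<l with join (mono i j k l i<j j<k k<l) b
          ...   | inj₁ (_ , bj) =
            none b (a i) (a j) (a k) (inj₂ (inj₂ (inj₂ refl))) (inj₁ refl) (inj₂ (inj₁ refl)) (inj₂ (inj₂ (inj₁ refl)))
              (∉range distinct i) (∉range distinct j) (∉range distinct k)
              (apart distinct i<j) (apart distinct (<-trans i<j j<k)) (apart distinct j<k)
              (weak₃ j<k k<l i<j j<k param x₀ x₁ x₂ bj)
          ...   | inj₂ (kb , _) =
            none (a i) (a j) (a k) b (inj₁ refl) (inj₂ (inj₁ refl)) (inj₂ (inj₂ (inj₁ refl))) (inj₂ (inj₂ (inj₂ refl)))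
              (apart distinct i<j) (apart distinct (<-trans i<j j<k)) (≢-sym (∉range distinct i))
              (apart distinct j<k) (≢-sym (∉range distinct j)) (≢-sym (∉range distinct k)) kb
          ∉monoHull _ (inj₂ (inj₂ (inj₂ (i , j , k , l , i<j , j<k , k<l , d , e)))) =
            D2 (weak₃ (<-trans i<j j<k) k<l i<j (<-trans j<k k<l) x₀ param x₁ x₂ d) e

      -- Avoiding the hull is sufficient

      module _ (avoids : ∀ x → B x → ¬ InHullSeq M I s x) where

        limit-exists : ∀ {b} → B b → ∀ c {i j} → s i c ≢ s j c → ∃[ ε ] Limit ε b (comp c)
        limit-exists {b} b∈B c ne with Component.petaled⊎monotonic s unb ind c ne
        ... | inj₁ petaled = hi , petaled⇒limit petaled (λ h → avoids b b∈B (c , inj₁ (petaled , h)))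
        ... | inj₂ mono    = monotonic⇒limit unb mono (λ h → avoids b b∈B (c , inj₂ (mono , h)))

        module _ {m : ℕ} {ι κ : Fin m → Idx} (same : SameOrder ι κ) where

          -- Moving a formula whose cut splits a component.

          module Framed (C : Cut) {i₀ : Idx} (F : Frame ι κ i₀) where
            open Cut C
            open Frame F

            V : Set
            V = Fin m ⊎ (End × Bool)

            var : Fin m → V
            var = inj₁

            mv : ∀ (t₁ t₂ t₃ t₄ : V × Fin n) →
              let ev = λ (f : Fin m → Idx) (t : V × Fin n) → s (place f (proj₁ t)) (proj₂ t) in
              D (ev ι t₁) (ev ι t₂) (ev ι t₃) (ev ι t₄) → D (ev κ t₁) (ev κ t₂) (ev κ t₃) (ev κ t₄)
            mv = move (place-sameOrder same)

            limit-at : ∀ {b} → B b → ∀ {c i j} → In (s i c) → Out (s j c) → ∃[ ε ] Limit ε b (comp c)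
            limit-at b∈B {c} i-in j-out =
              limit-exists b∈B c (λ e → exclusive (subst In e i-in) j-out)

            -- Otherwise `Limit` would place `κ p` farther towards ε than a far index.
            not-joined : ∀ {ε b c p} → Limit ε b (comp c) →
                         ¬ D b (s (κ p) c) (s (E ε false) c) (s (E ε true) c)
            not-joined {ε} {p = p} lim d =
              <[]-asym ε (κ< ε false p) (proj₁ (lim (distinct ε) (swapʳ (flip d))))

            -- x y | b with the component of x split by the cut: b may be replaced by
            -- a far term of that component.
            far-term : ∀ {b} → B b → Out b → ∀ {p c q d} → In (s (ι p) c) → In (s (ι q) d) → Out (s i₀ c) →
              ∃[ ε ] (∀ x → Out (s (E ε x) c)) × D (s (κ p) c) (s (κ q) d) (s (E ε false) c) b
            far-term {b} b∈B b-out {p} {c} {q} {d} p-in q-in i₀-out with limit-at b∈B p-in i₀-out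
            ... | ε , lim = ε , far-out , result
              where
              far-out : ∀ x → Out (s (E ε x) c)
              far-out x = limit ε C lim b-out p-in i₀-out (ι< ε x p) (base< ε x)
              result : D (s (κ p) c) (s (κ q) d) (s (E ε false) c) b
              result with join (mv (var p , c) (var q , d) (inj₂ (ε , false) , c) (inj₂ (ε , true) , c)
                                   (cut p-in q-in (far-out false) (far-out true))) b
              ... | inj₁ (bp , _) = ⊥-elim (not-joined lim bp)
              ... | inj₂ (Eb , _) = Eb

            -- With E a far term, pq|rE is free of parameters and moves; `far-term` adds pq|Eb, and
            -- E is eliminated.
            one-left : ∀ {b} → B b → Out b → ∀ {p c q d r e} →
              In (s (ι p) c) → In (s (ι q) d) → Out (s (ι r) e) → Out (s i₀ c) →
              D (s (κ p) c) (s (κ q) d) (s (κ r) e) b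
            one-left b∈B b-out {p} {c} {q} {d} {r} {e} p-in q-in r-out i₀-out =
              let ε , far-out , Eb = far-term b∈B b-out {p} {c} {q} {d} p-in q-in i₀-out in D-transʳ
              (mv (var p , c) (var q , d) (var r , e) (inj₂ (ε , false) , c) (cut p-in q-in r-out (far-out false))) Eb

            -- Here pq|rE moves, with E a far term of the component e. If r is still outside at κ,
            -- the cut itself witnesses the result. If it is inside, the cut gives pr|bE, so b
            -- cannot join p against r and E.
            one-right : ∀ {b} → B b → Out b → ∀ {p c q d r e} →
              (∀ i → In (s i c)) → (∀ i → In (s i d)) → Out (s (ι r) e) → In (s i₀ e) →
              D (s (κ p) c) (s (κ q) d) (s (κ r) e) b
            one-right {b} b∈B b-out {p} {c} {q} {d} {r} {e} c-in d-in r-out i₀-in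
              with limit-at b∈B i₀-in r-out
            ... | ε , lim = result
              where
              far-out : Out (s (E ε false) e)
              far-out = limit ε C lim b-out i₀-in r-out (base< ε false) (ι< ε false r)
              result : D (s (κ p) c) (s (κ q) d) (s (κ r) e) b
              result with side (s (κ r) e)
                        | join (mv (var p , c) (var q , d) (var r , e) (inj₂ (ε , false) , e)
                                   (cut (c-in (ι p)) (d-in (ι q)) r-out far-out)) b
              ... | inj₂ out | _             = cut (c-in (κ p)) (d-in (κ q)) out b-out
              ... | inj₁ _   | inj₂ (rb , _) = rb
              ... | inj₁ r-in | inj₁ (bp , _) = ⊥-elim (D2 (cut (c-in (κ p)) r-in b-out far-out) (swapˡ bp))

            -- Opposite p, q the points b, E, E′, b′ are linked one after the other; only the middle
            -- link is moved.
            two-left : ∀ {b b′} → B b → B b′ → Out b → Out b′ → ∀ {p c q d} →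
              In (s (ι p) c) → In (s (ι q) d) → Out (s i₀ c) → D (s (κ p) c) (s (κ q) d) b b′
            two-left b∈B b′∈B b-out b′-out {p} {c} {q} {d} p-in q-in i₀-out =
              let ε  , far-out  , Eb   = far-term b∈B b-out {p} {c} {q} {d} p-in q-in i₀-out
                  ε′ , far-out′ , E′b′ = far-term b′∈B b′-out {p} {c} {q} {d} p-in q-in i₀-out
              in D-transʳ (swapʳ Eb) (D-transʳ
              (mv (var p , c) (var q , d) (inj₂ (ε , false) , c) (inj₂ (ε′ , false) , c)
                  (cut p-in q-in (far-out false) (far-out′ false))) E′b′)

            -- Here b and b′ are limits of the component c at opposite ends.
            mixed : ∀ {b b′} → B b → B b′ → In b → Out b′ → ∀ {p c} → In (s (ι p) c) → Out (s i₀ c) →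
              ∃[ ε′ ] (∀ x → Out (s (E ε′ x) c)) ×
                      D (s (κ p) c) b (s (E ε′ false) c) b′ ×
                      (∀ v {d} → Out (s (place ι v) d) → D (s (κ p) c) b (s (place κ v) d) (s (E ε′ false) c))
            mixed {b} {b′} b∈B b′∈B b-in b′-out {p} {c} p-in i₀-out
              with limit-at b∈B p-in i₀-out | limit-at b′∈B p-in i₀-out
            ... | ε , lim | ε′ , lim′ = ε′ , far-out , far-b′ , far-var
              where
              far-in : ∀ x → In (s (E ε x) c)
              far-in x = limit ε (opposite C) lim b-in i₀-out p-in (base< ε x) (ι< ε x p)
              far-out : ∀ x → Out (s (E ε′ x) c)
              far-out x = limit ε′ C lim′ b′-out p-in i₀-out (ι< ε′ x p) (base< ε′ x)
              -- `Limit` forces `ε` and `ε′` to be the same end, but the far terms at `ε` are inside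
              -- and those at `ε′` outside.
              no-b : ∀ {x} → ¬ D (s (κ p) c) (s (E ε false) c) (s (E ε′ x) c) b
              no-b {x} d with same-end ε ε′ (proj₁ (lim (λ e → <[]-irrefl ε (subst (κ p <[ ε ]_) (sym e) (κ< ε false p))) d))
              ... | refl = exclusive (far-in x) (far-out x)
              far-var : ∀ (v : V) {d} → Out (s (place ι v) d) → D (s (κ p) c) b (s (place κ v) d) (s (E ε′ false) c)
              far-var v {d} out
                with join (mv (var p , c) (inj₂ (ε , false) , c) (v , d) (inj₂ (ε′ , false) , c)
                              (cut p-in (far-in false) out (far-out false))) b
              ... | inj₁ (bp , _) = swapˡ bp
              ... | inj₂ (_ , Eb) = ⊥-elim (no-b Eb)
              far-b′ : D (s (κ p) c) b (s (E ε′ false) c) b′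
              -- Both far terms at `ε′` lie opposite `κ p` and b, so `not-joined` keeps b′ from
              -- joining `κ p`.
              far-b′ with join (swapʳ (far-var (inj₂ (ε′ , true)) (far-out true))) b′
              ... | inj₁ (b′p , _) = ⊥-elim (not-joined lim′ b′p)
              ... | inj₂ (Eb′ , _) = Eb′

            two-mixed : ∀ {b b′} → B b → B b′ → In b → Out b′ → ∀ {p c q d} →
              In (s (ι p) c) → Out (s (ι q) d) → Out (s i₀ c) → D (s (κ p) c) b (s (κ q) d) b′
            two-mixed b∈B b′∈B b-in b′-out {p} {c} {q} p-in q-out i₀-out =
              let _ , _ , Eb′ , far-var = mixed b∈B b′∈B b-in b′-out {p} {c} p-in i₀-out
              in D-transʳ (far-var (var q) q-out) Eb′

            -- The chain b′, E′, E″, b″ is linked opposite p, b; the far term E″ serves as the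
            -- variable in `far-var`.
            three-mixed : ∀ {b b′ b″} → B b → B b′ → B b″ → In b → Out b′ → Out b″ → ∀ {p c} →
              In (s (ι p) c) → Out (s i₀ c) → D (s (κ p) c) b b′ b″
            three-mixed b∈B b′∈B b″∈B b-in b′-out b″-out {p} {c} p-in i₀-out =
              let _  , _       , Eb′  , far-var = mixed b∈B b′∈B b-in b′-out {p} {c} p-in i₀-out
                  ε″ , far-out″ , E″b″ , _      = mixed b∈B b″∈B b-in b″-out {p} {c} p-in i₀-out
              in D-transʳ (swapʳ Eb′) (D-transʳ (swapʳ (far-var (inj₂ (ε″ , false)) (far-out″ false))) E″b″)

          -- Formulas by the number of their parameters.

          private
            frame-at : ∀ i₀ → Frame ι κ i₀
            frame-at = frame unb ι κ

          no-param : ∀ p c q d r e t f → D (s (ι p) c) (s (ι q) d) (s (ι r) e) (s (ι t) f) →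
                     D (s (κ p) c) (s (κ q) d) (s (κ r) e) (s (κ t) f)
          no-param p c q d r e t f = move same (p , c) (q , d) (r , e) (t , f)

          -- A component split by the cut crosses it at some index i, which becomes the base of the
          -- frame. If none is split, every term stays on its side and the cut witnesses the
          -- instance at κ. The lemmas with more parameters follow the same plan.
          one-param : ∀ {b} → B b → ∀ p c q d r e → D (s (ι p) c) (s (ι q) d) (s (ι r) e) b →
                      D (s (κ p) c) (s (κ q) d) (s (κ r) e) b
          one-param b∈B p c q d r e h with cutOf h
          ... | C , sep = result em em em
            where
            open Cut C
            open Separates sep
            result : Dec (∃[ i ] Out (s i c)) → Dec (∃[ i ] Out (s i d)) → Dec (∃[ i ] In (s i e)) → _
            result (yes (i , out)) _ _ =
              Framed.one-left C (frame-at i) b∈B out₂ in₁ in₂ out₁ out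
            result (no _) (yes (i , out)) _ =
              swapˡ (Framed.one-left C (frame-at i) b∈B out₂ in₂ in₁ out₁ out)
            result (no c-in) (no d-in) (yes (i , in₀)) =
              Framed.one-right C (frame-at i) b∈B out₂ (all-In (comp c) c-in) (all-In (comp d) d-in) out₁ in₀
            result (no c-in) (no d-in) (no e-out) =
              cut (all-In (comp c) c-in _) (all-In (comp d) d-in _) (Cut.all-In (opposite C) (comp e) e-out _) out₂

          two-params : ∀ {b b′} → B b → B b′ → ∀ p c q d → D (s (ι p) c) (s (ι q) d) b b′ →
                       D (s (κ p) c) (s (κ q) d) b b′
          two-params b∈B b′∈B p c q d h with cutOf h
          ... | C , sep = result em em
            where
            open Cut C
            open Separates sep
            result : Dec (∃[ i ] Out (s i c)) → Dec (∃[ i ] Out (s i d)) → _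
            result (yes (i , out)) _ =
              Framed.two-left C (frame-at i) b∈B b′∈B out₁ out₂ in₁ in₂ out
            result (no _) (yes (i , out)) =
              swapˡ (Framed.two-left C (frame-at i) b∈B b′∈B out₁ out₂ in₂ in₁ out)
            result (no c-in) (no d-in) =
              cut (all-In (comp c) c-in _) (all-In (comp d) d-in _) out₁ out₂

          two-params-mixed : ∀ {b b′} → B b → B b′ → ∀ p c q d → D (s (ι p) c) b (s (ι q) d) b′ →
                             D (s (κ p) c) b (s (κ q) d) b′
          two-params-mixed b∈B b′∈B p c q d h with cutOf h
          ... | C , sep = result em em
            where
            open Cut C
            open Separates sep
            result : Dec (∃[ i ] Out (s i c)) → Dec (∃[ i ] In (s i d)) → _
            result (yes (i , out)) _ =
              Framed.two-mixed C (frame-at i) b∈B b′∈B in₂ out₂ in₁ out₁ out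
            -- Now the other variable belongs to the split component; reversing the cut exchanges
            -- the roles.
            result (no _) (yes (i , in₀)) =
              flip (Framed.two-mixed (opposite C) (frame-at i) b′∈B b∈B out₂ in₂ out₁ in₁ in₀)
            result (no c-in) (no d-out) =
              cut (all-In (comp c) c-in _) in₂ (Cut.all-In (opposite C) (comp d) d-out _) out₂

          three-params : ∀ {b b′ b″} → B b → B b′ → B b″ → ∀ p c → D (s (ι p) c) b b′ b″ →
                         D (s (κ p) c) b b′ b″
          three-params b∈B b′∈B b″∈B p c h with cutOf h
          ... | C , sep = result em
            where
            open Cut C
            open Separates sep
            result : Dec (∃[ i ] Out (s i c)) → _
            result (yes (i , out)) =
              Framed.three-mixed C (frame-at i) b∈B b′∈B b″∈B in₂ out₁ out₂ in₁ out
            result (no c-in) = cut (all-In (comp c) c-in _) in₂ out₁ out₂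

          -- The symmetries of D bring each placement of parameters to one of the shapes treated
          -- above; with four parameters nothing changes.
          transfer : ∀ (t₁ t₂ t₃ t₄ : Term M I m n B) →
            let ev = evalT M I s ι ; ev′ = evalT M I s κ in
            D (ev t₁) (ev t₂) (ev t₃) (ev t₄) → D (ev′ t₁) (ev′ t₂) (ev′ t₃) (ev′ t₄)
          transfer (inj₁ (p , c)) (inj₁ (q , d)) (inj₁ (r , e)) (inj₁ (t , f)) h = no-param p c q d r e t f h
          transfer (inj₁ (p , c)) (inj₁ (q , d)) (inj₁ (r , e)) (inj₂ (_ , β)) h = one-param β p c q d r e h
          transfer (inj₁ (p , c)) (inj₁ (q , d)) (inj₂ (_ , β)) (inj₁ (r , e)) h =
            swapʳ (one-param β p c q d r e (swapʳ h))
          transfer (inj₁ (p , c)) (inj₂ (_ , β)) (inj₁ (q , d)) (inj₁ (r , e)) h =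
            flip (one-param β q d r e p c (flip h))
          transfer (inj₂ (_ , β)) (inj₁ (p , c)) (inj₁ (q , d)) (inj₁ (r , e)) h =
            flip (swapʳ (one-param β q d r e p c (swapʳ (flip h))))
          transfer (inj₁ (p , c)) (inj₁ (q , d)) (inj₂ (_ , β)) (inj₂ (_ , β′)) h = two-params β β′ p c q d h
          transfer (inj₂ (_ , β)) (inj₂ (_ , β′)) (inj₁ (p , c)) (inj₁ (q , d)) h =
            flip (two-params β β′ p c q d (flip h))
          transfer (inj₁ (p , c)) (inj₂ (_ , β)) (inj₁ (q , d)) (inj₂ (_ , β′)) h = two-params-mixed β β′ p c q d h
          transfer (inj₁ (p , c)) (inj₂ (_ , β)) (inj₂ (_ , β′)) (inj₁ (q , d)) h =
            swapʳ (two-params-mixed β β′ p c q d (swapʳ h))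
          transfer (inj₂ (_ , β)) (inj₁ (p , c)) (inj₁ (q , d)) (inj₂ (_ , β′)) h =
            swapˡ (two-params-mixed β β′ p c q d (swapˡ h))
          transfer (inj₂ (_ , β)) (inj₁ (p , c)) (inj₂ (_ , β′)) (inj₁ (q , d)) h =
            swapˡ (swapʳ (two-params-mixed β β′ p c q d (swapˡ (swapʳ h))))
          transfer (inj₁ (p , c)) (inj₂ (_ , β)) (inj₂ (_ , β′)) (inj₂ (_ , β″)) h = three-params β β′ β″ p c h
          transfer (inj₂ (_ , β)) (inj₁ (p , c)) (inj₂ (_ , β′)) (inj₂ (_ , β″)) h =
            swapˡ (three-params β β′ β″ p c (swapˡ h))
          transfer (inj₂ (_ , β)) (inj₂ (_ , β′)) (inj₁ (p , c)) (inj₂ (_ , β″)) h =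
            flip (three-params β″ β β′ p c (flip h))
          transfer (inj₂ (_ , β)) (inj₂ (_ , β′)) (inj₂ (_ , β″)) (inj₁ (p , c)) h =
            flip (swapˡ (three-params β″ β β′ p c (swapˡ (flip h))))
          transfer (inj₂ _) (inj₂ _) (inj₂ _) (inj₂ _) h = h

mainTheorem18 : ExcludedMiddle (suc 0ℓ) →
    (M : DStructure) (I : LinOrder) (n : ℕ)
    (s : LinOrder.Idx I → Fin n → DStructure.Ω M) →
    Unbounded I →
    Indiscernible M I s →
    (B : DStructure.Ω M → Set) →
    (WeaklyIndiscernible M I s B ⇔
    (∀ x → B x → ¬ InHullSeq M I s x))
mainTheorem18 em₁ M I n s unb ind B = mk⇔
  (λ weak x x∈B → λ
    { (c , inj₁ ((distinct , _) , hull)) → ∉petalHull weak x∈B c distinct hull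
    ; (c , inj₂ (mono , hull))           → ∉monoHull weak x∈B c mono hull })
  (λ avoids m t₁ t₂ t₃ t₄ ι κ incι incκ → mk⇔
    (transfer avoids (increasing⇒sameOrder incι incκ) t₁ t₂ t₃ t₄)
    (transfer avoids (increasing⇒sameOrder incκ incι) t₁ t₂ t₃ t₄))
  where
  em : ExcludedMiddle 0ℓ
  em = map′ lower lift em₁
  open Classical em M using (module Sequences)
  open Sequences I
  open WeakIndiscernibility s unb ind B
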